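{- The logics $\mathit{S1SP}_\equiv$, $\mathit{S3}_\equiv$, $\mathit{S4}_\equiv$ and $\mathit{S5}_\equiv$ are the dual $\mathit{SCI}$-theories of the modal logics $\mathit{S1SP}$, $\mathit{S3}$, $\mathit{S4}$ and $\mathit{S5}$, respectively.
   Context: Languages: $Fm_\equiv$ is the set of formulas built from variables $V=\{x_0,x_1,\dots\}$, $\bot,\top,\neg,\vee,\wedge,\rightarrow$ and a binary connective $\equiv$. $Fm_\square$ is built from the same variables and classical connectives and a unary operator $\square$. $\varphi\leftrightarrow\psi$ abbreviates $(\varphi\rightarrow\psi)\wedge(\psi\rightarrow\varphi)$. In $Fm_\equiv$, $\square\varphi$ abbreviates $\varphi\equiv\top$. In $Fm_\square$, $\varphi\equiv\psi$ abbreviates $\square(\varphi\leftrightarrow\psi)$. $\mathit{SCI}$ (in $Fm_\equiv$): axioms are all substitution instances of classical tautologies and all formulas $\varphi\equiv\varphi$; $(\varphi\equiv\psi)\rightarrow(\varphi\rightarrow\psi)$; $(\varphi\equiv\psi)\rightarrow(\neg\varphi\equiv\neg\psi)$; $((\varphi_1\equiv\psi_1)\wedge(\varphi_2\equiv\psi_2))\rightarrow((\varphi_1*\varphi_2)\equiv(\psi_1*\psi_2))$, $*\in\{\vee,\wedge,\rightarrow,\equiv\}$; rule Modus Ponens (MP). Schemes, read in either language: (CPC) substitution instances of classical tautologies; (1) $(\chi\equiv\psi)\leftrightarrow\square(\chi\leftrightarrow\psi)$; (2) $\square\varphi\rightarrow\varphi$; (3') $(\square(\varphi\rightarrow\psi)\wedge\square(\psi\rightarrow\chi))\rightarrow\square(\varphi\rightarrow\chi)$;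 (3) $\square(\varphi\rightarrow\psi)\rightarrow\square(\square\varphi\rightarrow\square\psi)$; (4) $\square\varphi\rightarrow\square\square\varphi$; (5) $\neg\square\varphi\rightarrow\square\neg\square\varphi$; SP: $(\varphi\equiv\psi)\rightarrow(\chi[x:=\varphi]\equiv\chi[x:=\psi])$. In each system below, $\varPhi\vdash\varphi$ means there is a finite sequence ending in $\varphi$ each member of which is in $\varPhi$, or an axiom, or $\square\psi$ for an axiom $\psi$ (rule AN, Axiom Necessitation), or (for $\mathit{S1SP}$ and $\mathit{S1SP}_\equiv$) an instance of SP (SP is not an axiom, so AN does not apply to it), or obtained from earlier members by MP. Modal systems in $Fm_\square$: $\mathit{S1SP}$ has axioms (CPC), (2), (3') plus theorem scheme SP; $\mathit{S3}$ has axioms (CPC), (2), (3'), (3); $\mathit{S4}$ adds axiom (4) to $\mathit{S3}$; $\mathit{S5}$ adds axiom (5) to $\mathit{S4}$. Systems in $Fm_\equiv$ (with $\square\varphi:=(\varphi\equiv\top)$): $\mathit{S1SP}_\equiv$ has axioms (CPC), (1), (2), (3') plus theorem scheme SP; $\mathit{S3}_\equiv$ has axioms (CPC), (1), (2), (3); $\mathit{S4}_\equiv$ has axioms (CPC), (1), (2), (3), (4); $\mathit{S5}_\equiv$ has axioms (CPC), (1), (2), (3), (4), (5). Translations: $\mathit{box}\colon Fm_\equiv\to Fm_\square$ is the identity on variables, $\bot$, $\top$, commutes with $\neg,\wedge,\vee,\rightarrow$, and $\mathit{box}(\varphi\equiv\psi):=\square(\mathit{box}(\varphi)\leftrightarrow\mathit{box}(\psi))$.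 $\mathit{id}\colon Fm_\square\to Fm_\equiv$ is the identity on variables, $\bot$, $\top$, commutes with $\neg,\wedge,\vee,\rightarrow$, and $\mathit{id}(\square\varphi):=(\mathit{id}(\varphi)\equiv\top)$. For sets $\varPhi$, $\mathit{box}(\varPhi)$ and $\mathit{id}(\varPhi)$ are the elementwise images. Duality: Let $\mathcal{L}$ be a modal logic in $Fm_\square$ containing $\mathit{S1SP}$, and let $\mathcal{L}_\equiv$ be an extension of $\mathit{SCI}$ in $Fm_\equiv$ containing all formulas $(\chi\equiv\psi)\equiv\square(\chi\leftrightarrow\psi)$ as theorems. $\mathcal{L}_\equiv$ is called the dual $\mathit{SCI}$-theory of $\mathcal{L}$ if one of the following two conditions holds: (i) for all $\varPhi\cup\{\varphi\}\subseteq Fm_\equiv$: $\varPhi\vdash_{\mathcal{L}_\equiv}\varphi\Leftrightarrow\mathit{box}(\varPhi)\vdash_{\mathcal{L}}\mathit{box}(\varphi)$; (ii) for all $\varPhi\cup\{\varphi\}\subseteq Fm_\square$: $\varPhi\vdash_{\mathcal{L}}\varphi\Leftrightarrow\mathit{id}(\varPhi)\vdash_{\mathcal{L}_\equiv}\mathit{id}(\varphi)$. (The claim includes that each pair of systems satisfies the prerequisites on $\mathcal{L}$ and $\mathcal{L}_\equiv$.) -}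

module Defs where

open import Level using (0ℓ)
open import Data.Bool.Base as Bool using (Bool; true; false; if_then_else_)
open import Data.List.Base using (List; []; _∷_)
open import Data.List.Membership.Propositional using (_∈_)
open import Data.Nat.Base using (ℕ)
open import Data.Nat.Properties using (_≟_)
open import Data.Product.Base using (∃-syntax; _×_)
open import Data.Sum.Base using (_⊎_)
open import Function.Bundles using (_⇔_)
open import Relation.Binary.PropositionalEquality using (_≡_)
open import Relation.Nullary.Decidable using (does)
open import Relation.Unary using (Pred; ∅; _∪_)

-- Classical propositional logic, used only to say what a tautology is.
module Classical where

  infix  9 ¬_
  infixr 7 _∧_
  infixr 6 _∨_
  infixr 5 _⇒_

  data Formula : Set where
    var         : ℕ → Formula
    ⊥ ⊤         : Formula
    ¬_          : Formula → Formula
    _∨_ _∧_ _⇒_ : Formula → Formula → Formula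

  eval : (ℕ → Bool) → Formula → Bool
  eval v (var n) = v n
  eval v ⊥       = false
  eval v ⊤       = true
  eval v (¬ φ)   = Bool.not (eval v φ)
  eval v (φ ∨ ψ) = eval v φ Bool.∨ eval v ψ
  eval v (φ ∧ ψ) = eval v φ Bool.∧ eval v ψ
  eval v (φ ⇒ ψ) = Bool.not (eval v φ) Bool.∨ eval v ψ

  Tautology : Formula → Set
  Tautology φ = ∀ v → eval v φ ≡ true

-- What the axiom schemes need to know about a language, so that they can be
-- read both where □ is primitive and where the identity connective _≣_ is.
record Language : Set₁ where
  infix  9 ¬_ □_
  infixr 7 _∧_
  infixr 6 _∨_
  infixr 5 _⇒_
  infix  4 _↔_ _≣_
  infix  10 _[_:=_]

  field
    Formula     : Set
    var         : ℕ → Formula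
    ⊥ ⊤         : Formula
    ¬_ □_       : Formula → Formula
    _∨_ _∧_ _⇒_ : Formula → Formula → Formula
    _≣_         : Formula → Formula → Formula
    _[_:=_]     : Formula → ℕ → Formula → Formula

  _↔_ : Formula → Formula → Formula
  φ ↔ ψ = (φ ⇒ ψ) ∧ (ψ ⇒ φ)

  instantiate : (ℕ → Formula) → Classical.Formula → Formula
  instantiate σ (Classical.var n)   = σ n
  instantiate σ Classical.⊥         = ⊥
  instantiate σ Classical.⊤         = ⊤
  instantiate σ (Classical.¬ φ)     = ¬ instantiate σ φ
  instantiate σ (φ Classical.∨ ψ)   = instantiate σ φ ∨ instantiate σ ψ
  instantiate σ (φ Classical.∧ ψ)   = instantiate σ φ ∧ instantiate σ ψ
  instantiate σ (φ Classical.⇒ ψ)   = instantiate σ φ ⇒ instantiate σ ψ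

-- A logic whose only rule is Modus Ponens: it is given by the formulas that may
-- enter a derivation unconditionally. Axiom Necessitation and theorem schemes
-- contribute such formulas (see AN and SP below).
record Logic (L : Language) : Set₁ where
  constructor logic
  open Language L
  field
    Initial : Pred Formula 0ℓ

module _ {L : Language} where
  open Language L

  data Justified (Φ : Pred Formula 0ℓ) (𝓛 : Logic L) (earlier : List Formula)
                 (φ : Formula) : Set where
    premise : Φ φ → Justified Φ 𝓛 earlier φ
    initial : Logic.Initial 𝓛 φ → Justified Φ 𝓛 earlier φ
    mp      : ∀ ψ → (ψ ⇒ φ) ∈ earlier → ψ ∈ earlier → Justified Φ 𝓛 earlier φ

  -- Derivations are listed with the last formula first.
  data Derivation (Φ : Pred Formula 0ℓ) (𝓛 : Logic L) : List Formula → Set where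
    []  : Derivation Φ 𝓛 []
    _∷_ : ∀ {φ φs} → Justified Φ 𝓛 φs φ → Derivation Φ 𝓛 φs →
          Derivation Φ 𝓛 (φ ∷ φs)

  infix 3 _⊢[_]_

  _⊢[_]_ : Pred Formula 0ℓ → Logic L → Formula → Set
  Φ ⊢[ 𝓛 ] φ = ∃[ φs ] Derivation Φ 𝓛 (φ ∷ φs)

  -- The inclusion is between consequence relations; Φ = ∅ gives the inclusion
  -- between sets of theorems, and is equivalent to it.
  _Extends_ : Logic L → Logic L → Set₁
  𝓛 Extends 𝓛′ = ∀ (Φ : Pred Formula 0ℓ) φ → Φ ⊢[ 𝓛′ ] φ → Φ ⊢[ 𝓛 ] φ

module Schemes (L : Language) where
  open Language L

  data CPC : Pred Formula 0ℓ where
    cpc : ∀ τ → Classical.Tautology τ → ∀ σ → CPC (instantiate σ τ)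

  data Identity : Pred Formula 0ℓ where
    identity : ∀ χ ψ → Identity ((χ ≣ ψ) ↔ □ (χ ↔ ψ))

  data Reflexivity : Pred Formula 0ℓ where
    reflexivity : ∀ φ → Reflexivity (□ φ ⇒ φ)

  data StrictTransitivity : Pred Formula 0ℓ where
    strictTransitivity : ∀ φ ψ χ →
      StrictTransitivity ((□ (φ ⇒ ψ) ∧ □ (ψ ⇒ χ)) ⇒ □ (φ ⇒ χ))

  data StrictMonotonicity : Pred Formula 0ℓ where
    strictMonotonicity : ∀ φ ψ →
      StrictMonotonicity (□ (φ ⇒ ψ) ⇒ □ (□ φ ⇒ □ ψ))

  data Four : Pred Formula 0ℓ where
    four : ∀ φ → Four (□ φ ⇒ □ □ φ)

  data Five : Pred Formula 0ℓ where
    five : ∀ φ → Five (¬ □ φ ⇒ □ ¬ □ φ)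

  data SP : Pred Formula 0ℓ where
    sp : ∀ φ ψ χ x → SP ((φ ≣ ψ) ⇒ (χ [ x := φ ] ≣ χ [ x := ψ ]))

  data AN (Axiom : Pred Formula 0ℓ) : Pred Formula 0ℓ where
    axiom       : ∀ {φ} → Axiom φ → AN Axiom φ
    necessitate : ∀ {φ} → Axiom φ → AN Axiom (□ φ)

infix  9 ¬_ □_
infixr 7 _∧_
infixr 6 _∨_
infixr 5 _⇒_
infix  4 _≣_

data Fm≡ : Set where
  var             : ℕ → Fm≡
  ⊥ ⊤             : Fm≡
  ¬_              : Fm≡ → Fm≡
  _∨_ _∧_ _⇒_ _≣_ : Fm≡ → Fm≡ → Fm≡

data Fm□ : Set where
  var         : ℕ → Fm□
  ⊥ ⊤         : Fm□
  ¬_ □_       : Fm□ → Fm□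
  _∨_ _∧_ _⇒_ : Fm□ → Fm□ → Fm□

substitute≡ : Fm≡ → ℕ → Fm≡ → Fm≡
substitute≡ (var y) x θ = if does (y ≟ x) then θ else var y
substitute≡ ⊥       x θ = ⊥
substitute≡ ⊤       x θ = ⊤
substitute≡ (¬ φ)   x θ = ¬ substitute≡ φ x θ
substitute≡ (φ ∨ ψ) x θ = substitute≡ φ x θ ∨ substitute≡ ψ x θ
substitute≡ (φ ∧ ψ) x θ = substitute≡ φ x θ ∧ substitute≡ ψ x θ
substitute≡ (φ ⇒ ψ) x θ = substitute≡ φ x θ ⇒ substitute≡ ψ x θ
substitute≡ (φ ≣ ψ) x θ = substitute≡ φ x θ ≣ substitute≡ ψ x θ

substitute□ : Fm□ → ℕ → Fm□ → Fm□
substitute□ (var y) x θ = if does (y ≟ x) then θ else var y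
substitute□ ⊥       x θ = ⊥
substitute□ ⊤       x θ = ⊤
substitute□ (¬ φ)   x θ = ¬ substitute□ φ x θ
substitute□ (□ φ)   x θ = □ substitute□ φ x θ
substitute□ (φ ∨ ψ) x θ = substitute□ φ x θ ∨ substitute□ ψ x θ
substitute□ (φ ∧ ψ) x θ = substitute□ φ x θ ∧ substitute□ ψ x θ
substitute□ (φ ⇒ ψ) x θ = substitute□ φ x θ ⇒ substitute□ ψ x θ

language≡ : Language
language≡ = record
  { Formula = Fm≡ ; var = var ; ⊥ = ⊥ ; ⊤ = ⊤ ; ¬_ = ¬_
  ; □_ = λ φ → φ ≣ ⊤
  ; _∨_ = _∨_ ; _∧_ = _∧_ ; _⇒_ = _⇒_
  ; _≣_ = _≣_
  ; _[_:=_] = substitute≡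
  }

language□ : Language
language□ = record
  { Formula = Fm□ ; var = var ; ⊥ = ⊥ ; ⊤ = ⊤ ; ¬_ = ¬_
  ; □_ = □_
  ; _∨_ = _∨_ ; _∧_ = _∧_ ; _⇒_ = _⇒_
  ; _≣_ = λ φ ψ → □ ((φ ⇒ ψ) ∧ (ψ ⇒ φ))
  ; _[_:=_] = substitute□
  }

module _ where
  open Schemes language□

  S3Axiom S4Axiom S5Axiom : Pred Fm□ 0ℓ
  S3Axiom = CPC ∪ Reflexivity ∪ StrictTransitivity ∪ StrictMonotonicity
  S4Axiom = S3Axiom ∪ Four
  S5Axiom = S4Axiom ∪ Five

  S1SP S3 S4 S5 : Logic language□
  S1SP = logic (AN (CPC ∪ Reflexivity ∪ StrictTransitivity) ∪ SP)
  S3   = logic (AN S3Axiom)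
  S4   = logic (AN S4Axiom)
  S5   = logic (AN S5Axiom)

module _ where
  open Schemes language≡

  S1SP≡ S3≡ S4≡ S5≡ : Logic language≡
  S1SP≡ = logic (AN (CPC ∪ Identity ∪ Reflexivity ∪ StrictTransitivity) ∪ SP)
  S3≡   = logic (AN (CPC ∪ Identity ∪ Reflexivity ∪ StrictMonotonicity))
  S4≡   = logic (AN (CPC ∪ Identity ∪ Reflexivity ∪ StrictMonotonicity ∪ Four))
  S5≡   = logic (AN (CPC ∪ Identity ∪ Reflexivity ∪ StrictMonotonicity ∪ Four ∪ Five))

  data SCIAxiom : Pred Fm≡ 0ℓ where
    classical : ∀ {φ} → CPC φ → SCIAxiom φ
    refl≣     : ∀ φ → SCIAxiom (φ ≣ φ)
    ≣-elim    : ∀ φ ψ → SCIAxiom ((φ ≣ ψ) ⇒ (φ ⇒ ψ))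
    ¬-cong    : ∀ φ ψ → SCIAxiom ((φ ≣ ψ) ⇒ (¬ φ ≣ ¬ ψ))
    ∨-cong    : ∀ φ₁ ψ₁ φ₂ ψ₂ →
      SCIAxiom (((φ₁ ≣ ψ₁) ∧ (φ₂ ≣ ψ₂)) ⇒ ((φ₁ ∨ φ₂) ≣ (ψ₁ ∨ ψ₂)))
    ∧-cong    : ∀ φ₁ ψ₁ φ₂ ψ₂ →
      SCIAxiom (((φ₁ ≣ ψ₁) ∧ (φ₂ ≣ ψ₂)) ⇒ ((φ₁ ∧ φ₂) ≣ (ψ₁ ∧ ψ₂)))
    ⇒-cong    : ∀ φ₁ ψ₁ φ₂ ψ₂ →
      SCIAxiom (((φ₁ ≣ ψ₁) ∧ (φ₂ ≣ ψ₂)) ⇒ ((φ₁ ⇒ φ₂) ≣ (ψ₁ ⇒ ψ₂)))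
    ≣-cong    : ∀ φ₁ ψ₁ φ₂ ψ₂ →
      SCIAxiom (((φ₁ ≣ ψ₁) ∧ (φ₂ ≣ ψ₂)) ⇒ ((φ₁ ≣ φ₂) ≣ (ψ₁ ≣ ψ₂)))

-- No Axiom Necessitation here: φ ≣ ⊤ is not an SCI theorem for every tautology φ.
SCI : Logic language≡
SCI = logic SCIAxiom

box : Fm≡ → Fm□
box (var n) = var n
box ⊥       = ⊥
box ⊤       = ⊤
box (¬ φ)   = ¬ box φ
box (φ ∨ ψ) = box φ ∨ box ψ
box (φ ∧ ψ) = box φ ∧ box ψ
box (φ ⇒ ψ) = box φ ⇒ box ψ
box (φ ≣ ψ) = □ (box φ ↔ box ψ)
  where open Language language□ using (_↔_)

id : Fm□ → Fm≡
id (var n) = var n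
id ⊥       = ⊥
id ⊤       = ⊤
id (¬ φ)   = ¬ id φ
id (φ ∨ ψ) = id φ ∨ id ψ
id (φ ∧ ψ) = id φ ∧ id ψ
id (φ ⇒ ψ) = id φ ⇒ id ψ
id (□ φ)   = id φ ≣ ⊤

image : {A B : Set} → (A → B) → Pred A 0ℓ → Pred B 0ℓ
image f Φ ψ = ∃[ φ ] Φ φ × f φ ≡ ψ

BoxCondition : Logic language□ → Logic language≡ → Set₁
BoxCondition 𝓛 𝓛≡ = ∀ (Φ : Pred Fm≡ 0ℓ) φ →
  (Φ ⊢[ 𝓛≡ ] φ) ⇔ (image box Φ ⊢[ 𝓛 ] box φ)

IdCondition : Logic language□ → Logic language≡ → Set₁
IdCondition 𝓛 𝓛≡ = ∀ (Φ : Pred Fm□ 0ℓ) φ →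
  (Φ ⊢[ 𝓛 ] φ) ⇔ (image id Φ ⊢[ 𝓛≡ ] id φ)

record _IsDualSCITheoryOf_ (𝓛≡ : Logic language≡) (𝓛 : Logic language□) : Set₁ where
  open Language language≡ using (_↔_) renaming (□_ to □≡_)
  field
    containsS1SP     : 𝓛 Extends S1SP
    extendsSCI       : 𝓛≡ Extends SCI
    identityTheorems : ∀ χ ψ → ∅ ⊢[ 𝓛≡ ] ((χ ≣ ψ) ≣ (□≡ (χ ↔ ψ)))
    duality          : BoxCondition 𝓛 𝓛≡ ⊎ IdCondition 𝓛 𝓛≡

{-# OPTIONS --safe #-}

-- In every system at hand, provable strict equivalence is a congruence for all
-- connectives, relative to any set of premises: in the S3 family by Strict
-- Monotonicity, in the S1SP family by SP. Hence □ φ and φ ≣ ⊤ can be replaced by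
-- one another, so that φ ≣ box (id φ) is a theorem. As id and box map the axioms
-- of either system to theorems of the other, condition (ii) of duality follows:
-- apply box to a derivation of id φ and cancel box ∘ id.
module Submission where

open import Level using (Level; 0ℓ)
open import Data.Bool.Base as Bool using (Bool; true; false; if_then_else_)
open import Data.Bool.Properties using (if-float)
open import Data.List.Base using (List; []; _∷_; _++_)
open import Data.List.Membership.Propositional using (_∈_)
open import Data.List.Membership.Propositional.Properties using (∈-++⁺ˡ; ∈-++⁺ʳ)
open import Data.List.Relation.Unary.All as All using (All; []; _∷_)
open import Data.List.Relation.Unary.Any using (here)
open import Data.Nat.Base using (ℕ; zero; suc; _≡ᵇ_)
open import Data.Nat.Properties using (_≟_; ≡ᵇ⇒≡)
open import Data.Product.Base using (_×_; _,_)
open import Data.Sum.Base as Sum using (inj₁; inj₂; [_,_])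
open import Function.Base as Fun using (_∘_)
open import Function.Bundles using (mk⇔)
open import Relation.Binary.PropositionalEquality
  using (_≡_; refl; sym; trans; cong; cong₂; subst)
open import Relation.Nullary.Decidable using (does)
open import Relation.Unary using (Pred; _∪_; _⊆_; ｛_｝)

open import Defs using
  ( module Classical; Language; Logic; logic; Justified; premise; initial; mp
  ; Derivation; []; _∷_; _⊢[_]_; _Extends_; module Schemes
  ; Fm≡; Fm□; substitute≡; substitute□; language≡; language□
  ; S1SP; S3; S4; S5; S1SP≡; S3≡; S4≡; S5≡; SCI; box; id
  ; image; IdCondition; _IsDualSCITheoryOf_
  )

private
  module C = Classical
  variable
    ℓ : Level

-- Tautologies

_C↔_ : C.Formula → C.Formula → C.Formula
α C↔ β = (α C.⇒ β) C.∧ (β C.⇒ α)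

infix 4 _C↔_

p q r s t : C.Formula
p = C.var 0
q = C.var 1
r = C.var 2
s = C.var 3
t = C.var 4

-- Valuations are functions, and rewriting a variable with its own value returns the original only
-- pointwise.
eval-cong : ∀ {v w} → (∀ n → v n ≡ w n) → ∀ τ → C.eval v τ ≡ C.eval w τ
eval-cong v≗w (C.var n)  = v≗w n
eval-cong v≗w C.⊥        = refl
eval-cong v≗w C.⊤        = refl
eval-cong v≗w (C.¬ α)    = cong Bool.not (eval-cong v≗w α)
eval-cong v≗w (α C.∨ β)  = cong₂ Bool._∨_ (eval-cong v≗w α) (eval-cong v≗w β)
eval-cong v≗w (α C.∧ β)  = cong₂ Bool._∧_ (eval-cong v≗w α) (eval-cong v≗w β)
eval-cong v≗w (α C.⇒ β)  =
  cong₂ (λ a b → Bool.not a Bool.∨ b) (eval-cong v≗w α) (eval-cong v≗w β)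

_[_↦_] : (ℕ → Bool) → ℕ → Bool → ℕ → Bool
(v [ k ↦ b ]) n = if n ≡ᵇ k then b else v n

update-self : ∀ v k {b} → v k ≡ b → ∀ n → (v [ k ↦ b ]) n ≡ v n
update-self v k vk≡b n with n ≡ᵇ k in n≡ᵇk
... | true  = trans (sym vk≡b) (cong v (sym (≡ᵇ⇒≡ n k (subst Bool.T (sym n≡ᵇk) _))))
... | false = refl

-- Only the first `n` variables are case-split. If these include all variables of `τ`, the table
-- computes to a closed boolean even for an unknown `v`, so `refl` decides tautologies.
truthTable : ℕ → (ℕ → Bool) → C.Formula → Bool
truthTable zero    v τ = C.eval v τ
truthTable (suc n) v τ =
  truthTable n (v [ n ↦ true ]) τ Bool.∧ truthTable n (v [ n ↦ false ]) τ

∧-true : ∀ {a b} → a Bool.∧ b ≡ true → a ≡ true × b ≡ true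
∧-true {true} {true} _ = refl , refl

-- At each split, one branch assigns the variable the value it already has under `v`, so that branch
-- evaluates `τ` under `v` up to pointwise equality.
truthTable-sound : ∀ n v τ → truthTable n v τ ≡ true → C.eval v τ ≡ true
truthTable-sound zero    v τ holds = holds
truthTable-sound (suc n) v τ holds with ∧-true holds | v n in vn≡
... | holds-t , _ | true  =
  trans (sym (eval-cong (update-self v n vn≡) τ))
        (truthTable-sound n (v [ n ↦ true ]) τ holds-t)
... | _ , holds-f | false =
  trans (sym (eval-cong (update-self v n vn≡) τ))
        (truthTable-sound n (v [ n ↦ false ]) τ holds-f)

-- Consequence relations

module _ {L : Language} {𝓛 : Logic L} where
  open Language L

  private
    variable
      Φ : Pred Formula 0ℓ
      φ ψ : Formula

  ⊢-premise : Φ φ → Φ ⊢[ 𝓛 ] φ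
  ⊢-premise Φφ = [] , premise Φφ ∷ []

  ⊢-initial : Logic.Initial 𝓛 φ → Φ ⊢[ 𝓛 ] φ
  ⊢-initial i = [] , initial i ∷ []

  Justified-weaken : ∀ {φs} ψs → Justified Φ 𝓛 φs φ → Justified Φ 𝓛 (φs ++ ψs) φ
  Justified-weaken ψs (premise Φφ)     = premise Φφ
  Justified-weaken ψs (initial i)      = initial i
  Justified-weaken ψs (mp ψ ψ⇒φ∈ ψ∈)   = mp ψ (∈-++⁺ˡ ψ⇒φ∈) (∈-++⁺ˡ ψ∈)

  Derivation-++ : ∀ {φs ψs} →
    Derivation Φ 𝓛 φs → Derivation Φ 𝓛 ψs → Derivation Φ 𝓛 (φs ++ ψs)
  Derivation-++           []      e = e
  Derivation-++ {ψs = ψs} (j ∷ d) e = Justified-weaken ψs j ∷ Derivation-++ d e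

  infixl 5 _·_

  _·_ : Φ ⊢[ 𝓛 ] φ ⇒ ψ → Φ ⊢[ 𝓛 ] φ → Φ ⊢[ 𝓛 ] ψ
  _·_ {φ = φ} (φs , d) (ψs , e) =
    -- The derivation of the implication stands in front, so its conclusion heads the list and `φ`
    -- heads the second half.
    _ , mp φ (here refl) (∈-++⁺ʳ (_ ∷ φs) (here refl)) ∷ Derivation-++ d e

  module _ (P : Pred Formula ℓ) (P-premise : Φ ⊆ P) (P-initial : Logic.Initial 𝓛 ⊆ P)
           (P-mp : ∀ {φ ψ} → P (φ ⇒ ψ) → P φ → P ψ) where

    -- `P` is established for all members at once, because modus ponens may cite any earlier
    -- formula.
    Derivation-induction : ∀ {φs} → Derivation Φ 𝓛 φs → All P φs
    Derivation-induction []      = []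
    Derivation-induction (j ∷ d) = step j ∷ earlier
      where
      earlier = Derivation-induction d
      step : ∀ {φ} → Justified _ 𝓛 _ φ → P φ
      step (premise Φφ)       = P-premise Φφ
      step (initial i)        = P-initial i
      step (mp ψ ψ⇒φ∈ ψ∈)     = P-mp (All.lookup earlier ψ⇒φ∈) (All.lookup earlier ψ∈)

    ⊢-induction : Φ ⊢[ 𝓛 ] φ → P φ
    ⊢-induction (_ , d) = All.head (Derivation-induction d)

module _ {L : Language} where
  open Language L
  open Schemes L

  -- Strict equivalence as a congruence

  Necessary : Logic L → Pred Formula 0ℓ → Set₁
  Necessary 𝓛 A = ∀ {Φ φ} → A φ → Φ ⊢[ 𝓛 ] □ φ

  -- This much suffices for classical reasoning and the deduction theorem. It is kept apart from
  -- `Congruential`, whose fields are derived with its help.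
  record Identifying (𝓛 : Logic L) : Set₁ where
    field
      □-cpc      : Necessary 𝓛 CPC
      □-identity : Necessary 𝓛 Identity
      □-elim     : ∀ {Φ φ} → Φ ⊢[ 𝓛 ] □ φ → Φ ⊢[ 𝓛 ] φ

    private
      variable
        Φ : Pred Formula 0ℓ
        φ ψ : Formula

    assign : List Formula → ℕ → Formula
    -- Default past the end of the list; the tautologies below keep all their variables within it.
    assign []       _       = ⊥
    assign (φ ∷ _)  zero    = φ
    assign (_ ∷ φs) (suc n) = assign φs n

    □-taut : ∀ n τ φs → (∀ v → truthTable n v τ ≡ true) →
             Φ ⊢[ 𝓛 ] □ instantiate (assign φs) τ
    □-taut n τ φs holds =
      □-cpc (cpc τ (λ v → truthTable-sound n v τ (holds v)) (assign φs))

    taut : ∀ n τ φs → (∀ v → truthTable n v τ ≡ true) →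
           Φ ⊢[ 𝓛 ] instantiate (assign φs) τ
    taut n τ φs holds = □-elim (□-taut n τ φs holds)

    ∧-intro : Φ ⊢[ 𝓛 ] φ → Φ ⊢[ 𝓛 ] ψ → Φ ⊢[ 𝓛 ] φ ∧ ψ
    ∧-intro ⊢φ ⊢ψ = taut 2 (p C.⇒ q C.⇒ p C.∧ q) (_ ∷ _ ∷ []) (λ _ → refl) · ⊢φ · ⊢ψ

    ∧-elimˡ : Φ ⊢[ 𝓛 ] φ ∧ ψ → Φ ⊢[ 𝓛 ] φ
    ∧-elimˡ ⊢φ∧ψ = taut 2 (p C.∧ q C.⇒ p) (_ ∷ _ ∷ []) (λ _ → refl) · ⊢φ∧ψ

    ∧-elimʳ : Φ ⊢[ 𝓛 ] φ ∧ ψ → Φ ⊢[ 𝓛 ] ψ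
    ∧-elimʳ ⊢φ∧ψ = taut 2 (p C.∧ q C.⇒ q) (_ ∷ _ ∷ []) (λ _ → refl) · ⊢φ∧ψ

    ≣⇒□↔ : Φ ⊢[ 𝓛 ] φ ≣ ψ → Φ ⊢[ 𝓛 ] □ (φ ↔ ψ)
    ≣⇒□↔ ⊢φ≣ψ = ∧-elimˡ (□-elim (□-identity (identity _ _))) · ⊢φ≣ψ

    □↔⇒≣ : Φ ⊢[ 𝓛 ] □ (φ ↔ ψ) → Φ ⊢[ 𝓛 ] φ ≣ ψ
    □↔⇒≣ ⊢□φ↔ψ = ∧-elimʳ (□-elim (□-identity (identity _ _))) · ⊢□φ↔ψ

    ≣-taut : ∀ n α β φs → (∀ v → truthTable n v (α C↔ β) ≡ true) →
             Φ ⊢[ 𝓛 ] instantiate (assign φs) α ≣ instantiate (assign φs) β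
    ≣-taut n α β φs holds = □↔⇒≣ (□-taut n (α C↔ β) φs holds)

    ≣-transport : Φ ⊢[ 𝓛 ] φ ≣ ψ → Φ ⊢[ 𝓛 ] φ → Φ ⊢[ 𝓛 ] ψ
    ≣-transport ⊢φ≣ψ ⊢φ = ∧-elimˡ (□-elim (≣⇒□↔ ⊢φ≣ψ)) · ⊢φ

    ≣-transport⁻¹ : Φ ⊢[ 𝓛 ] φ ≣ ψ → Φ ⊢[ 𝓛 ] ψ → Φ ⊢[ 𝓛 ] φ
    ≣-transport⁻¹ ⊢φ≣ψ ⊢ψ = ∧-elimʳ (□-elim (≣⇒□↔ ⊢φ≣ψ)) · ⊢ψ

    ≣-identity : Φ ⊢[ 𝓛 ] (φ ≣ ψ) ≣ (□ (φ ↔ ψ))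
    ≣-identity = □↔⇒≣ (□-identity (identity _ _))

    hypothesis : (Φ ∪ ｛ φ ｝) ⊢[ 𝓛 ] φ
    hypothesis = ⊢-premise (inj₂ refl)

    -- Necessitated axioms count as initial formulas, so modus ponens is the only rule to be treated
    -- and the classical argument applies.
    deduction : (Φ ∪ ｛ φ ｝) ⊢[ 𝓛 ] ψ → Φ ⊢[ 𝓛 ] φ ⇒ ψ
    deduction {Φ} {φ} = ⊢-induction (λ ψ → Φ ⊢[ 𝓛 ] φ ⇒ ψ)
      (λ { (inj₁ Φψ)   → constant (⊢-premise Φψ)
         ; (inj₂ refl) → taut 1 (p C.⇒ p) (_ ∷ []) (λ _ → refl)
         })
      (λ i → constant (⊢-initial i))
      (λ ⊢φ⇒ψ⇒χ ⊢φ⇒ψ →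
        taut 3 ((p C.⇒ q C.⇒ r) C.⇒ (p C.⇒ q) C.⇒ p C.⇒ r) (_ ∷ _ ∷ _ ∷ [])
             (λ _ → refl) · ⊢φ⇒ψ⇒χ · ⊢φ⇒ψ)
      where
      constant : ∀ {ψ} → Φ ⊢[ 𝓛 ] ψ → Φ ⊢[ 𝓛 ] φ ⇒ ψ
      constant ⊢ψ = taut 2 (p C.⇒ q C.⇒ p) (_ ∷ _ ∷ []) (λ _ → refl) · ⊢ψ

  -- The rules hold over arbitrary premises, so they can be applied to a temporary hypothesis that
  -- `deduction` then discharges.
  record Congruential (𝓛 : Logic L) : Set₁ where
    field
      identifying : Identifying 𝓛
    open Identifying identifying public
    field
      □-mp   : ∀ {Φ φ ψ} → Φ ⊢[ 𝓛 ] □ (φ ⇒ ψ) → Φ ⊢[ 𝓛 ] □ φ → Φ ⊢[ 𝓛 ] □ ψ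
      □-cong : ∀ {Φ φ ψ} → Φ ⊢[ 𝓛 ] φ ≣ ψ → Φ ⊢[ 𝓛 ] □ φ ≣ □ ψ

    private
      variable
        Φ : Pred Formula 0ℓ
        φ ψ χ φ₁ ψ₁ φ₂ ψ₂ : Formula

    ≣-refl : Φ ⊢[ 𝓛 ] φ ≣ φ
    ≣-refl = ≣-taut 1 p p (_ ∷ []) (λ _ → refl)

    -- Here and in the truth-functional congruences below, a tautology about `↔` is necessitated and
    -- its antecedents are detached under `□`.
    ≣-sym : Φ ⊢[ 𝓛 ] φ ≣ ψ → Φ ⊢[ 𝓛 ] ψ ≣ φ
    ≣-sym ⊢φ≣ψ = □↔⇒≣
      (□-mp (□-taut 2 ((p C↔ q) C.⇒ (q C↔ p)) (_ ∷ _ ∷ []) (λ _ → refl)) (≣⇒□↔ ⊢φ≣ψ))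

    ≣-trans : Φ ⊢[ 𝓛 ] φ ≣ ψ → Φ ⊢[ 𝓛 ] ψ ≣ χ → Φ ⊢[ 𝓛 ] φ ≣ χ
    ≣-trans ⊢φ≣ψ ⊢ψ≣χ = □↔⇒≣
      (□-mp (□-mp (□-taut 3 ((p C↔ q) C.⇒ (q C↔ r) C.⇒ (p C↔ r)) (_ ∷ _ ∷ _ ∷ [])
                          (λ _ → refl))
                  (≣⇒□↔ ⊢φ≣ψ))
            (≣⇒□↔ ⊢ψ≣χ))

    ¬-congruence : Φ ⊢[ 𝓛 ] φ ≣ ψ → Φ ⊢[ 𝓛 ] ¬ φ ≣ ¬ ψ
    ¬-congruence ⊢φ≣ψ = □↔⇒≣
      (□-mp (□-taut 2 ((p C↔ q) C.⇒ (C.¬ p C↔ C.¬ q)) (_ ∷ _ ∷ []) (λ _ → refl))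
            (≣⇒□↔ ⊢φ≣ψ))

    -- Taking `τ` as a function on formulas covers the compound `_C↔_` along with the primitive
    -- connectives; for a concrete `τ`, `instantiate` computes.
    connective-congruence : (τ : C.Formula → C.Formula → C.Formula) →
      (∀ v → truthTable 4 v ((p C↔ r) C.⇒ (q C↔ s) C.⇒ (τ p q C↔ τ r s)) ≡ true) →
      Φ ⊢[ 𝓛 ] φ₁ ≣ ψ₁ → Φ ⊢[ 𝓛 ] φ₂ ≣ ψ₂ →
      let σ = assign (φ₁ ∷ φ₂ ∷ ψ₁ ∷ ψ₂ ∷ []) in
      Φ ⊢[ 𝓛 ] instantiate σ (τ p q) ≣ instantiate σ (τ r s)
    connective-congruence {φ₁ = φ₁} {ψ₁} {φ₂} {ψ₂} τ holds ⊢φ₁≣ψ₁ ⊢φ₂≣ψ₂ = □↔⇒≣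
      (□-mp (□-mp (□-taut 4 ((p C↔ r) C.⇒ (q C↔ s) C.⇒ (τ p q C↔ τ r s))
                          (φ₁ ∷ φ₂ ∷ ψ₁ ∷ ψ₂ ∷ []) holds)
                  (≣⇒□↔ ⊢φ₁≣ψ₁))
            (≣⇒□↔ ⊢φ₂≣ψ₂))

    ∨-congruence : Φ ⊢[ 𝓛 ] φ₁ ≣ ψ₁ → Φ ⊢[ 𝓛 ] φ₂ ≣ ψ₂ →
                   Φ ⊢[ 𝓛 ] (φ₁ ∨ φ₂) ≣ (ψ₁ ∨ ψ₂)
    ∨-congruence = connective-congruence C._∨_ (λ _ → refl)

    ∧-congruence : Φ ⊢[ 𝓛 ] φ₁ ≣ ψ₁ → Φ ⊢[ 𝓛 ] φ₂ ≣ ψ₂ →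
                   Φ ⊢[ 𝓛 ] (φ₁ ∧ φ₂) ≣ (ψ₁ ∧ ψ₂)
    ∧-congruence = connective-congruence C._∧_ (λ _ → refl)

    ⇒-congruence : Φ ⊢[ 𝓛 ] φ₁ ≣ ψ₁ → Φ ⊢[ 𝓛 ] φ₂ ≣ ψ₂ →
                   Φ ⊢[ 𝓛 ] (φ₁ ⇒ φ₂) ≣ (ψ₁ ⇒ ψ₂)
    ⇒-congruence = connective-congruence C._⇒_ (λ _ → refl)

    ↔-congruence : Φ ⊢[ 𝓛 ] φ₁ ≣ ψ₁ → Φ ⊢[ 𝓛 ] φ₂ ≣ ψ₂ →
                   Φ ⊢[ 𝓛 ] (φ₁ ↔ φ₂) ≣ (ψ₁ ↔ ψ₂)
    ↔-congruence = connective-congruence _C↔_ (λ _ → refl)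

    ≣-congruence : Φ ⊢[ 𝓛 ] φ₁ ≣ ψ₁ → Φ ⊢[ 𝓛 ] φ₂ ≣ ψ₂ →
                   Φ ⊢[ 𝓛 ] (φ₁ ≣ φ₂) ≣ (ψ₁ ≣ ψ₂)
    ≣-congruence ⊢φ₁≣ψ₁ ⊢φ₂≣ψ₂ =
      ≣-trans ≣-identity
        (≣-trans (□-cong (↔-congruence ⊢φ₁≣ψ₁ ⊢φ₂≣ψ₂)) (≣-sym ≣-identity))

    -- By a tautology `ψ` is strictly equivalent to `ψ ↔ ⊤`, and the identity scheme reads
    -- `□ (ψ ↔ ⊤)` as `ψ ≣ ⊤`. This exchanges the two forms of necessity.
    □≣⊤-congruence : Φ ⊢[ 𝓛 ] φ ≣ ψ → Φ ⊢[ 𝓛 ] □ φ ≣ (ψ ≣ ⊤)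
    □≣⊤-congruence ⊢φ≣ψ =
      ≣-trans (□-cong (≣-trans ⊢φ≣ψ (≣-taut 1 p (p C↔ C.⊤) (_ ∷ []) (λ _ → refl))))
              (≣-sym ≣-identity)

    □-transport : Φ ⊢[ 𝓛 ] φ ≣ ψ → Φ ⊢[ 𝓛 ] □ φ → Φ ⊢[ 𝓛 ] □ ψ
    □-transport ⊢φ≣ψ = ≣-transport (□-cong ⊢φ≣ψ)

  module _ {𝓛 : Logic L} (id𝓛 : Identifying 𝓛) where
    open Identifying id𝓛

    -- For detachment under `□`, rewrite `□ φ` as `□ (⊤ ⇒ φ)`, chain it with `□ (φ ⇒ ψ)`, and
    -- rewrite `□ (⊤ ⇒ ψ)` back.
    strictTransitivity-congruential : Necessary 𝓛 StrictTransitivity →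
      (∀ {Φ φ ψ} → Φ ⊢[ 𝓛 ] φ ≣ ψ → Φ ⊢[ 𝓛 ] □ φ ≣ □ ψ) → Congruential 𝓛
    strictTransitivity-congruential □-trans □-cong = record
      { identifying = id𝓛
      ; □-mp        = λ ⊢□φ⇒ψ ⊢□φ → ≣-transport⁻¹ □≣□⊤⇒
          (□-elim (□-trans (strictTransitivity _ _ _))
            · ∧-intro (≣-transport □≣□⊤⇒ ⊢□φ) ⊢□φ⇒ψ)
      ; □-cong      = □-cong
      }
      where
      □≣□⊤⇒ : ∀ {Φ φ} → Φ ⊢[ 𝓛 ] □ φ ≣ □ (⊤ ⇒ φ)
      □≣□⊤⇒ = □-cong (≣-taut 1 p (C.⊤ C.⇒ p) (_ ∷ []) (λ _ → refl))

    module _ (□-mono : Necessary 𝓛 StrictMonotonicity) where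
      private
        mono : ∀ {Φ φ ψ} → Φ ⊢[ 𝓛 ] □ (φ ⇒ ψ) → Φ ⊢[ 𝓛 ] □ (□ φ ⇒ □ ψ)
        mono ⊢□φ⇒ψ = □-elim (□-mono (strictMonotonicity _ _)) · ⊢□φ⇒ψ

        □-mp : ∀ {Φ φ ψ} → Φ ⊢[ 𝓛 ] □ (φ ⇒ ψ) → Φ ⊢[ 𝓛 ] □ φ → Φ ⊢[ 𝓛 ] □ ψ
        □-mp ⊢□φ⇒ψ ⊢□φ = □-elim (mono ⊢□φ⇒ψ) · ⊢□φ

      strictMonotonicity-congruential : Congruential 𝓛
      strictMonotonicity-congruential = record
        { identifying = id𝓛
        ; □-mp        = □-mp
        ; □-cong      = λ ⊢φ≣ψ → □↔⇒≣
            -- Each direction of `φ ↔ ψ` is extracted under `□` and lifted by `mono`; the two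
            -- results are then conjoined under `□`.
            (□-mp (□-mp (□-taut 2 (p C.⇒ q C.⇒ p C.∧ q) (_ ∷ _ ∷ []) (λ _ → refl))
                        (mono (□-mp (□-taut 2 (p C.∧ q C.⇒ p) (_ ∷ _ ∷ []) (λ _ → refl))
                                    (≣⇒□↔ ⊢φ≣ψ))))
                  (mono (□-mp (□-taut 2 (p C.∧ q C.⇒ q) (_ ∷ _ ∷ []) (λ _ → refl))
                              (≣⇒□↔ ⊢φ≣ψ))))
        }

      -- □ (ψ ⇒ χ) strictly implies □ ((φ ⇒ ψ) ⇒ (φ ⇒ χ)), which strictly implies
      -- □ (□ (φ ⇒ ψ) ⇒ □ (φ ⇒ χ)), from which the outer □ can be dropped strictly.
      strictTransitivity-necessary :
        Necessary 𝓛 Reflexivity → Necessary 𝓛 StrictTransitivity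
      strictTransitivity-necessary □-refl (strictTransitivity φ ψ χ) =
        □-mp (□-mp (□-mp
          (□-taut 5 ((p C.⇒ q) C.⇒ (q C.⇒ r) C.⇒ (r C.⇒ s C.⇒ t) C.⇒ s C.∧ p C.⇒ t)
                  (_ ∷ _ ∷ _ ∷ _ ∷ _ ∷ []) (λ _ → refl))
          (mono (□-taut 3 ((q C.⇒ r) C.⇒ (p C.⇒ q) C.⇒ p C.⇒ r) (φ ∷ ψ ∷ χ ∷ [])
                        (λ _ → refl))))
          (□-mono (strictMonotonicity _ _)))
          (□-refl (reflexivity _))

module _ where
  open Schemes
  open Language language□ using () renaming (_≣_ to _≣□_)
  open Defs using (var; ⊥; ⊤; ¬_; □_; _∨_; _∧_; _⇒_; _≣_)

  -- Homomorphy of the translations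

  box-instantiate : ∀ σ τ → box (Language.instantiate language≡ σ τ)
                            ≡ Language.instantiate language□ (box ∘ σ) τ
  box-instantiate σ (C.var n) = refl
  box-instantiate σ C.⊥       = refl
  box-instantiate σ C.⊤       = refl
  box-instantiate σ (C.¬ α)   = cong ¬_ (box-instantiate σ α)
  box-instantiate σ (α C.∨ β) = cong₂ _∨_ (box-instantiate σ α) (box-instantiate σ β)
  box-instantiate σ (α C.∧ β) = cong₂ _∧_ (box-instantiate σ α) (box-instantiate σ β)
  box-instantiate σ (α C.⇒ β) = cong₂ _⇒_ (box-instantiate σ α) (box-instantiate σ β)

  id-instantiate : ∀ σ τ → id (Language.instantiate language□ σ τ)
                           ≡ Language.instantiate language≡ (id ∘ σ) τ
  id-instantiate σ (C.var n) = refl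
  id-instantiate σ C.⊥       = refl
  id-instantiate σ C.⊤       = refl
  id-instantiate σ (C.¬ α)   = cong ¬_ (id-instantiate σ α)
  id-instantiate σ (α C.∨ β) = cong₂ _∨_ (id-instantiate σ α) (id-instantiate σ β)
  id-instantiate σ (α C.∧ β) = cong₂ _∧_ (id-instantiate σ α) (id-instantiate σ β)
  id-instantiate σ (α C.⇒ β) = cong₂ _⇒_ (id-instantiate σ α) (id-instantiate σ β)

  box-substitute : ∀ χ x θ → box (substitute≡ χ x θ) ≡ substitute□ (box χ) x (box θ)
  box-substitute (var y) x θ = if-float box (does (y ≟ x))
  box-substitute ⊥       x θ = refl
  box-substitute ⊤       x θ = refl
  box-substitute (¬ φ)   x θ = cong ¬_ (box-substitute φ x θ)
  box-substitute (φ ∨ ψ) x θ = cong₂ _∨_ (box-substitute φ x θ) (box-substitute ψ x θ)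
  box-substitute (φ ∧ ψ) x θ = cong₂ _∧_ (box-substitute φ x θ) (box-substitute ψ x θ)
  box-substitute (φ ⇒ ψ) x θ = cong₂ _⇒_ (box-substitute φ x θ) (box-substitute ψ x θ)
  box-substitute (φ ≣ ψ) x θ = cong₂ _≣□_ (box-substitute φ x θ) (box-substitute ψ x θ)

  id-substitute : ∀ χ x θ → id (substitute□ χ x θ) ≡ substitute≡ (id χ) x (id θ)
  id-substitute (var y) x θ = if-float id (does (y ≟ x))
  id-substitute ⊥       x θ = refl
  id-substitute ⊤       x θ = refl
  id-substitute (¬ φ)   x θ = cong ¬_ (id-substitute φ x θ)
  id-substitute (□ φ)   x θ = cong (_≣ ⊤) (id-substitute φ x θ)
  id-substitute (φ ∨ ψ) x θ = cong₂ _∨_ (id-substitute φ x θ) (id-substitute ψ x θ)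
  id-substitute (φ ∧ ψ) x θ = cong₂ _∧_ (id-substitute φ x θ) (id-substitute ψ x θ)
  id-substitute (φ ⇒ ψ) x θ = cong₂ _⇒_ (id-substitute φ x θ) (id-substitute ψ x θ)

  id-cpc : ∀ {φ} → CPC language□ φ → CPC language≡ (id φ)
  id-cpc (cpc τ taut σ) =
    subst (CPC language≡) (sym (id-instantiate σ τ)) (cpc τ taut (id ∘ σ))

  id-reflexivity : ∀ {φ} → Reflexivity language□ φ → Reflexivity language≡ (id φ)
  id-reflexivity (reflexivity φ) = reflexivity (id φ)

  id-strictTransitivity : ∀ {φ} →
    StrictTransitivity language□ φ → StrictTransitivity language≡ (id φ)
  id-strictTransitivity (strictTransitivity φ ψ χ) =
    strictTransitivity (id φ) (id ψ) (id χ)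

  id-strictMonotonicity : ∀ {φ} →
    StrictMonotonicity language□ φ → StrictMonotonicity language≡ (id φ)
  id-strictMonotonicity (strictMonotonicity φ ψ) = strictMonotonicity (id φ) (id ψ)

  id-four : ∀ {φ} → Four language□ φ → Four language≡ (id φ)
  id-four (four φ) = four (id φ)

  id-five : ∀ {φ} → Five language□ φ → Five language≡ (id φ)
  id-five (five φ) = five (id φ)

  box-cpc : ∀ {φ} → CPC language≡ φ → CPC language□ (box φ)
  box-cpc (cpc τ taut σ) =
    subst (CPC language□) (sym (box-instantiate σ τ)) (cpc τ taut (box ∘ σ))

  -- `box` sends `≣` exactly to the defined `≣` of `Fm□`, so instances go to instances.
  box-sp : ∀ {φ} → SP language≡ φ → SP language□ (box φ)
  box-sp (sp φ ψ χ x)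
    rewrite box-substitute χ x φ | box-substitute χ x ψ = sp (box φ) (box ψ) (box χ) x

  -- In Fm□ the identity scheme consists of instances of p ↔ p.
  identifying□ : {𝓛 : Logic language□} → Necessary 𝓛 (CPC language□) →
    (∀ {Φ φ} → Φ ⊢[ 𝓛 ] □ φ → Φ ⊢[ 𝓛 ] φ) → Identifying 𝓛
  identifying□ □-cpc □-elim = record
    { □-cpc      = □-cpc
    ; □-identity = λ { (identity χ ψ) →
        □-cpc (cpc (p C↔ p) (λ v → truthTable-sound 1 v (p C↔ p) refl) (λ _ → χ ≣□ ψ)) }
    ; □-elim     = □-elim
    }

  -- Replacement and translated axioms in congruential modal logics

  module CongruentialModal {𝓛 : Logic language□} (cong𝓛 : Congruential 𝓛) where
    open Congruential cong𝓛

    replacement : ∀ {Φ φ ψ} → Φ ⊢[ 𝓛 ] φ ≣□ ψ →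
                  ∀ χ x → Φ ⊢[ 𝓛 ] substitute□ χ x φ ≣□ substitute□ χ x ψ
    replacement ⊢φ≣ψ (var y) x with does (y ≟ x)
    ... | true  = ⊢φ≣ψ
    ... | false = ≣-refl
    replacement ⊢φ≣ψ ⊥       x = ≣-refl
    replacement ⊢φ≣ψ ⊤       x = ≣-refl
    replacement ⊢φ≣ψ (¬ χ)   x = ¬-congruence (replacement ⊢φ≣ψ χ x)
    replacement ⊢φ≣ψ (□ χ)   x = □-cong (replacement ⊢φ≣ψ χ x)
    replacement ⊢φ≣ψ (χ ∨ ξ) x =
      ∨-congruence (replacement ⊢φ≣ψ χ x) (replacement ⊢φ≣ψ ξ x)
    replacement ⊢φ≣ψ (χ ∧ ξ) x =
      ∧-congruence (replacement ⊢φ≣ψ χ x) (replacement ⊢φ≣ψ ξ x)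
    replacement ⊢φ≣ψ (χ ⇒ ξ) x =
      ⇒-congruence (replacement ⊢φ≣ψ χ x) (replacement ⊢φ≣ψ ξ x)

    -- Replacement works over any premises, in particular under the hypothesis `φ ≣ ψ` itself.
    SP-theorem : ∀ {Φ φ} → SP language□ φ → Φ ⊢[ 𝓛 ] φ
    SP-theorem (sp φ ψ χ x) = deduction (replacement hypothesis χ x)

    -- Only `□` is altered by the round trip: `□ φ` returns as `□ (box (id φ) ↔ ⊤)`.
    box-id : ∀ {Φ} φ → Φ ⊢[ 𝓛 ] φ ≣□ box (id φ)
    box-id (var n) = ≣-refl
    box-id ⊥       = ≣-refl
    box-id ⊤       = ≣-refl
    box-id (¬ φ)   = ¬-congruence (box-id φ)
    box-id (□ φ)   = □≣⊤-congruence (box-id φ)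
    box-id (φ ∨ ψ) = ∨-congruence (box-id φ) (box-id ψ)
    box-id (φ ∧ ψ) = ∧-congruence (box-id φ) (box-id ψ)
    box-id (φ ⇒ ψ) = ⇒-congruence (box-id φ) (box-id ψ)

    □⇒box□ : ∀ {Φ φ} → Φ ⊢[ 𝓛 ] □ box φ → Φ ⊢[ 𝓛 ] box (φ ≣ ⊤)
    □⇒box□ = ≣-transport (□≣⊤-congruence ≣-refl)

    □box-cpc : ∀ {Φ φ} → CPC language≡ φ → Φ ⊢[ 𝓛 ] □ box φ
    □box-cpc = □-cpc ∘ box-cpc

    -- With α for `box χ ↔ box ψ`, the translated instance compares `□ α` with `□ (α ↔ ⊤)`.
    □box-identity : ∀ {Φ φ} → Identity language≡ φ → Φ ⊢[ 𝓛 ] □ box φ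
    □box-identity (identity χ ψ) = ≣⇒□↔ (□≣⊤-congruence ≣-refl)

    -- In this and the following schemes, the translation differs from the modal axiom only by
    -- `□ (α ↔ ⊤)` in place of `□ α`, which is exchanged inside the outer `□`.
    □box-reflexivity : Necessary 𝓛 (Reflexivity language□) →
      ∀ {Φ φ} → Reflexivity language≡ φ → Φ ⊢[ 𝓛 ] □ box φ
    □box-reflexivity □-refl (reflexivity φ) =
      □-transport (⇒-congruence (□≣⊤-congruence ≣-refl) ≣-refl)
                  (□-refl (reflexivity (box φ)))

    □box-strictTransitivity : Necessary 𝓛 (StrictTransitivity language□) →
      ∀ {Φ φ} → StrictTransitivity language≡ φ → Φ ⊢[ 𝓛 ] □ box φ
    □box-strictTransitivity □-trans (strictTransitivity φ ψ χ) =
      □-transport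
        (⇒-congruence (∧-congruence (□≣⊤-congruence ≣-refl) (□≣⊤-congruence ≣-refl))
                      (□≣⊤-congruence ≣-refl))
        (□-trans (strictTransitivity (box φ) (box ψ) (box χ)))

    □box-strictMonotonicity : Necessary 𝓛 (StrictMonotonicity language□) →
      ∀ {Φ φ} → StrictMonotonicity language≡ φ → Φ ⊢[ 𝓛 ] □ box φ
    □box-strictMonotonicity □-mono (strictMonotonicity φ ψ) =
      □-transport
        (⇒-congruence (□≣⊤-congruence ≣-refl)
          (□≣⊤-congruence (⇒-congruence (□≣⊤-congruence ≣-refl) (□≣⊤-congruence ≣-refl))))
        (□-mono (strictMonotonicity (box φ) (box ψ)))

    □box-four : Necessary 𝓛 (Four language□) →
      ∀ {Φ φ} → Four language≡ φ → Φ ⊢[ 𝓛 ] □ box φ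
    □box-four □-four (four φ) =
      □-transport
        (⇒-congruence (□≣⊤-congruence ≣-refl) (□≣⊤-congruence (□≣⊤-congruence ≣-refl)))
        (□-four (four (box φ)))

    □box-five : Necessary 𝓛 (Five language□) →
      ∀ {Φ φ} → Five language≡ φ → Φ ⊢[ 𝓛 ] □ box φ
    □box-five □-five (five φ) =
      □-transport
        (⇒-congruence (¬-congruence (□≣⊤-congruence ≣-refl))
                      (□≣⊤-congruence (¬-congruence (□≣⊤-congruence ≣-refl))))
        (□-five (five (box φ)))

    -- A proof of `□ box φ` serves both cases: dropping `□` gives the axiom, and rewriting it as
    -- `box (φ ≣ ⊤)` gives its necessitation.
    AN-box : ∀ {A} → (∀ {Φ φ} → A φ → Φ ⊢[ 𝓛 ] □ box φ) →
             ∀ {Φ φ} → AN language≡ A φ → Φ ⊢[ 𝓛 ] box φ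
    AN-box □box-A (axiom Aφ)       = □-elim (□box-A Aφ)
    AN-box □box-A (necessitate Aφ) = □⇒box□ (□box-A Aφ)

  -- SCI and translated schemes in congruential identity theories

  module CongruentialSCI {𝓛≡ : Logic language≡} (cong𝓛≡ : Congruential 𝓛≡) where
    open Congruential cong𝓛≡

    SCI-theorem : ∀ {Φ φ} → Logic.Initial SCI φ → Φ ⊢[ 𝓛≡ ] φ
    SCI-theorem (Defs.classical φ-cpc)      = □-elim (□-cpc φ-cpc)
    SCI-theorem (Defs.refl≣ φ)              = ≣-refl
    SCI-theorem (Defs.≣-elim φ ψ)           =
      deduction (∧-elimˡ (□-elim (≣⇒□↔ hypothesis)))
    SCI-theorem (Defs.¬-cong φ ψ)           = deduction (¬-congruence hypothesis)
    SCI-theorem (Defs.∨-cong φ₁ ψ₁ φ₂ ψ₂)   =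
      deduction (∨-congruence (∧-elimˡ hypothesis) (∧-elimʳ hypothesis))
    SCI-theorem (Defs.∧-cong φ₁ ψ₁ φ₂ ψ₂)   =
      deduction (∧-congruence (∧-elimˡ hypothesis) (∧-elimʳ hypothesis))
    SCI-theorem (Defs.⇒-cong φ₁ ψ₁ φ₂ ψ₂)   =
      deduction (⇒-congruence (∧-elimˡ hypothesis) (∧-elimʳ hypothesis))
    SCI-theorem (Defs.≣-cong φ₁ ψ₁ φ₂ ψ₂)   =
      deduction (≣-congruence (∧-elimˡ hypothesis) (∧-elimʳ hypothesis))

    AN-id : ∀ {A} → (∀ {Φ φ} → A φ → Φ ⊢[ 𝓛≡ ] (id φ ≣ ⊤)) →
            ∀ {Φ φ} → AN language□ A φ → Φ ⊢[ 𝓛≡ ] id φ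
    AN-id □id-A (axiom Aφ)       = □-elim (□id-A Aφ)
    AN-id □id-A (necessitate Aφ) = □id-A Aφ

    -- `id` turns the strict equivalences into `(id φ ↔ id ψ) ≣ ⊤` rather than `id φ ≣ id ψ`, so the
    -- identity scheme converts before and after SP.
    SP-id : (∀ {Φ φ} → SP language≡ φ → Φ ⊢[ 𝓛≡ ] φ) →
            ∀ {Φ φ} → SP language□ φ → Φ ⊢[ 𝓛≡ ] id φ
    SP-id SP≡ (sp φ ψ χ x)
      rewrite id-substitute χ x φ | id-substitute χ x ψ =
      deduction (≣⇒□↔ (SP≡ (sp (id φ) (id ψ) (id χ) x) · □↔⇒≣ hypothesis))

  -- Inclusion of logics and the duality condition

  Extends-initial : ∀ {L} {𝓛 𝓛′ : Logic L} →
    (∀ {Φ φ} → Logic.Initial 𝓛′ φ → Φ ⊢[ 𝓛 ] φ) → 𝓛 Extends 𝓛′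
  Extends-initial {𝓛 = 𝓛} 𝓛′⊆𝓛 Φ φ =
    ⊢-induction (λ ψ → Φ ⊢[ 𝓛 ] ψ) ⊢-premise 𝓛′⊆𝓛 _·_

  module _ {𝓛 : Logic language□} {𝓛≡ : Logic language≡}
           (cong𝓛 : Congruential 𝓛) (cong𝓛≡ : Congruential 𝓛≡) where
    open CongruentialModal cong𝓛
    open CongruentialSCI cong𝓛≡
    open Congruential cong𝓛 using (≣-transport; ≣-transport⁻¹)
    open Congruential cong𝓛≡ using (≣-identity)

    idCondition : (∀ {Φ φ} → Logic.Initial 𝓛 φ → Φ ⊢[ 𝓛≡ ] id φ) →
                  (∀ {Φ φ} → Logic.Initial 𝓛≡ φ → Φ ⊢[ 𝓛 ] box φ) →
                  IdCondition 𝓛 𝓛≡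
    idCondition id-initial box-initial Φ φ = mk⇔
      (⊢-induction (λ ψ → image id Φ ⊢[ 𝓛≡ ] id ψ)
        (λ Φψ → ⊢-premise (_ , Φψ , refl)) id-initial _·_)
      (λ ⊢idφ → ≣-transport⁻¹ (box-id φ)
        (⊢-induction (λ ψ → Φ ⊢[ 𝓛 ] box ψ)
          -- A premise `id ψ` becomes `box (id ψ)`, which follows from the original premise `ψ`.
          (λ { (ψ , Φψ , refl) → ≣-transport (box-id ψ) (⊢-premise Φψ) })
          box-initial _·_ ⊢idφ))

    dual : 𝓛 Extends S1SP →
           (∀ {Φ φ} → Logic.Initial 𝓛 φ → Φ ⊢[ 𝓛≡ ] id φ) →
           (∀ {Φ φ} → Logic.Initial 𝓛≡ φ → Φ ⊢[ 𝓛 ] box φ) →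
           𝓛≡ IsDualSCITheoryOf 𝓛
    dual 𝓛⊇S1SP id-initial box-initial = record
      { containsS1SP     = 𝓛⊇S1SP
      ; extendsSCI       = Extends-initial SCI-theorem
      ; identityTheorems = λ χ ψ → ≣-identity
      ; duality          = inj₂ (idCondition id-initial box-initial)
      }

  module _ {L : Language} {𝓛 : Logic L} {A : Pred (Language.Formula L) 0ℓ}
           (AN⊆ : AN L A ⊆ Logic.Initial 𝓛) where

    -- An inclusion `AN⊆` instead of an equation admits the S1SP systems, where SP is initial but
    -- not subject to necessitation.
    AN-necessary : ∀ {B} → B ⊆ A → Necessary 𝓛 B
    AN-necessary B⊆A Bφ = ⊢-initial (AN⊆ (necessitate (B⊆A Bφ)))

    AN-□-elim : Reflexivity L ⊆ A →
      ∀ {Φ φ} → Φ ⊢[ 𝓛 ] Language.□_ L φ → Φ ⊢[ 𝓛 ] φ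
    AN-□-elim refl⊆A ⊢□φ = ⊢-initial (AN⊆ (axiom (refl⊆A (reflexivity _)))) · ⊢□φ

  -- The four pairs of systems

  S1SP-congruential : Congruential S1SP
  S1SP-congruential = strictTransitivity-congruential
    (identifying□ (AN-necessary inj₁ inj₁) (AN-□-elim inj₁ (inj₂ ∘ inj₁)))
    (AN-necessary inj₁ (inj₂ ∘ inj₂))
    -- Substituting into `□ x₀` makes SP the congruence of `□`.
    (λ ⊢φ≣ψ → ⊢-initial (inj₂ (sp _ _ (□ var 0) 0)) · ⊢φ≣ψ)

  S1SP≡-congruential : Congruential S1SP≡
  S1SP≡-congruential = strictTransitivity-congruential
    (record
      { □-cpc      = AN-necessary inj₁ inj₁
      ; □-identity = AN-necessary inj₁ (inj₂ ∘ inj₁)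
      ; □-elim     = AN-□-elim inj₁ (inj₂ ∘ inj₂ ∘ inj₁)
      })
    (AN-necessary inj₁ (inj₂ ∘ inj₂ ∘ inj₂))
    (λ ⊢φ≣ψ → ⊢-initial (inj₂ (sp _ _ (var 0 ≣ ⊤) 0)) · ⊢φ≣ψ)

  S1SP≡-dual : S1SP≡ IsDualSCITheoryOf S1SP
  S1SP≡-dual = dual S1SP-congruential S1SP≡-congruential
    (λ _ _ ⊢φ → ⊢φ)
    [ AN-id [ □-cpc ∘ id-cpc
            , [ AN-necessary inj₁ (inj₂ ∘ inj₂ ∘ inj₁) ∘ id-reflexivity
              , AN-necessary inj₁ (inj₂ ∘ inj₂ ∘ inj₂) ∘ id-strictTransitivity ] ]
    , SP-id (⊢-initial ∘ inj₂) ]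
    [ AN-box [ □box-cpc
             , [ □box-identity
               , [ □box-reflexivity (AN-necessary inj₁ (inj₂ ∘ inj₁))
                 , □box-strictTransitivity (AN-necessary inj₁ (inj₂ ∘ inj₂)) ] ] ]
    , ⊢-initial ∘ inj₂ ∘ box-sp ]
    where
    open Congruential S1SP≡-congruential using (□-cpc)
    open CongruentialModal S1SP-congruential
    open CongruentialSCI S1SP≡-congruential

  S3≡Axiom : Pred Fm≡ 0ℓ
  S3≡Axiom = CPC language≡ ∪ Identity language≡ ∪ Reflexivity language≡
             ∪ StrictMonotonicity language≡

  -- S3, S4 and S5 are treated together: congruentiality needs just the S3 axioms, and every further
  -- axiom is necessitated as well.
  module S3Extension {A□ : Pred Fm□ 0ℓ} {A≡ : Pred Fm≡ 0ℓ}
                     (S3⊆A□ : Defs.S3Axiom ⊆ A□) (S3⊆A≡ : S3≡Axiom ⊆ A≡) where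
    𝓛□ : Logic language□
    𝓛□ = logic (AN language□ A□)

    𝓛≡ : Logic language≡
    𝓛≡ = logic (AN language≡ A≡)

    □-axiom□ : Necessary 𝓛□ A□
    □-axiom□ = AN-necessary Fun.id Fun.id

    □-axiom≡ : Necessary 𝓛≡ A≡
    □-axiom≡ = AN-necessary Fun.id Fun.id

    congruential□ : Congruential 𝓛□
    congruential□ = strictMonotonicity-congruential
      (identifying□ (□-axiom□ ∘ S3⊆A□ ∘ inj₁)
                    (AN-□-elim Fun.id (S3⊆A□ ∘ inj₂ ∘ inj₁)))
      (□-axiom□ ∘ S3⊆A□ ∘ inj₂ ∘ inj₂ ∘ inj₂)

    identifying≡ : Identifying 𝓛≡
    identifying≡ = record
      { □-cpc      = □-axiom≡ ∘ S3⊆A≡ ∘ inj₁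
      ; □-identity = □-axiom≡ ∘ S3⊆A≡ ∘ inj₂ ∘ inj₁
      ; □-elim     = AN-□-elim Fun.id (S3⊆A≡ ∘ inj₂ ∘ inj₂ ∘ inj₁)
      }

    congruential≡ : Congruential 𝓛≡
    congruential≡ = strictMonotonicity-congruential identifying≡
      (□-axiom≡ ∘ S3⊆A≡ ∘ inj₂ ∘ inj₂ ∘ inj₂)

    open CongruentialModal congruential□ public
    open CongruentialSCI congruential≡ public

    extends-S1SP : 𝓛□ Extends S1SP
    extends-S1SP = Extends-initial
      [ (λ { (axiom Aφ)       → ⊢-initial (axiom (S1⊆A□ Aφ))
           ; (necessitate Aφ) → □-axiom□ (S1⊆A□ Aφ) })
      , SP-theorem ]
      where
      S1⊆A□ : (CPC language□ ∪ Reflexivity language□ ∪ StrictTransitivity language□) ⊆ A□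
      S1⊆A□ = S3⊆A□ ∘ [ inj₁ , inj₂ ∘ [ inj₁ , inj₂ ∘ inj₁ ] ]

    □id-S3Axiom : ∀ {Φ φ} → Defs.S3Axiom φ → Φ ⊢[ 𝓛≡ ] (id φ ≣ ⊤)
    □id-S3Axiom =
      [ □-axiom≡ ∘ S3⊆A≡ ∘ inj₁ ∘ id-cpc
      , [ □-axiom≡ ∘ S3⊆A≡ ∘ inj₂ ∘ inj₂ ∘ inj₁ ∘ id-reflexivity
        -- Strict transitivity is an axiom of `S3` but not of `S3≡`, so its necessitation is derived
        -- from monotonicity.
        , [ strictTransitivity-necessary identifying≡
              (□-axiom≡ ∘ S3⊆A≡ ∘ inj₂ ∘ inj₂ ∘ inj₂)
              (□-axiom≡ ∘ S3⊆A≡ ∘ inj₂ ∘ inj₂ ∘ inj₁) ∘ id-strictTransitivity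
          , □-axiom≡ ∘ S3⊆A≡ ∘ inj₂ ∘ inj₂ ∘ inj₂ ∘ id-strictMonotonicity ] ] ]

    □box-reflexivity′ : ∀ {Φ φ} → Reflexivity language≡ φ → Φ ⊢[ 𝓛□ ] □ box φ
    □box-reflexivity′ = □box-reflexivity (□-axiom□ ∘ S3⊆A□ ∘ inj₂ ∘ inj₁)

    □box-strictMonotonicity′ : ∀ {Φ φ} →
      StrictMonotonicity language≡ φ → Φ ⊢[ 𝓛□ ] □ box φ
    □box-strictMonotonicity′ =
      □box-strictMonotonicity (□-axiom□ ∘ S3⊆A□ ∘ inj₂ ∘ inj₂ ∘ inj₂)

    extension-dual : (∀ {Φ φ} → A□ φ → Φ ⊢[ 𝓛≡ ] (id φ ≣ ⊤)) →
                     (∀ {Φ φ} → A≡ φ → Φ ⊢[ 𝓛□ ] □ box φ) →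
                     𝓛≡ IsDualSCITheoryOf 𝓛□
    extension-dual □id-A □box-A =
      dual congruential□ congruential≡ extends-S1SP (AN-id □id-A) (AN-box □box-A)

  S3≡-dual : S3≡ IsDualSCITheoryOf S3
  S3≡-dual = extension-dual □id-S3Axiom
    [ □box-cpc , [ □box-identity , [ □box-reflexivity′ , □box-strictMonotonicity′ ] ] ]
    where open S3Extension {Defs.S3Axiom} {S3≡Axiom} Fun.id Fun.id

  S4≡-dual : S4≡ IsDualSCITheoryOf S4
  S4≡-dual = extension-dual
    [ □id-S3Axiom , □-axiom≡ ∘ inj₂ ∘ inj₂ ∘ inj₂ ∘ inj₂ ∘ id-four ]
    [ □box-cpc , [ □box-identity , [ □box-reflexivity′
      , [ □box-strictMonotonicity′ , □box-four (□-axiom□ ∘ inj₂) ] ] ] ]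
    where
    open S3Extension {Defs.S4Axiom}
      {CPC language≡ ∪ Identity language≡ ∪ Reflexivity language≡
       ∪ StrictMonotonicity language≡ ∪ Four language≡}
      -- `S4Axiom` adds `Four` outside `S3Axiom`, while the identity axioms form one right-nested
      -- union in which `StrictMonotonicity` is no longer last.
      inj₁ (Sum.map₂ (Sum.map₂ (Sum.map₂ inj₁)))

  S5≡-dual : S5≡ IsDualSCITheoryOf S5
  S5≡-dual = extension-dual
    [ [ □id-S3Axiom , □-axiom≡ ∘ inj₂ ∘ inj₂ ∘ inj₂ ∘ inj₂ ∘ inj₁ ∘ id-four ]
    , □-axiom≡ ∘ inj₂ ∘ inj₂ ∘ inj₂ ∘ inj₂ ∘ inj₂ ∘ id-five ]
    [ □box-cpc , [ □box-identity , [ □box-reflexivity′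
      , [ □box-strictMonotonicity′
        , [ □box-four (□-axiom□ ∘ inj₁ ∘ inj₂) , □box-five (□-axiom□ ∘ inj₂) ] ] ] ] ]
    where
    open S3Extension {Defs.S5Axiom}
      {CPC language≡ ∪ Identity language≡ ∪ Reflexivity language≡
       ∪ StrictMonotonicity language≡ ∪ Four language≡ ∪ Five language≡}
      (inj₁ ∘ inj₁) (Sum.map₂ (Sum.map₂ (Sum.map₂ inj₁)))

theorem5p9 : (S1SP≡ IsDualSCITheoryOf S1SP) × (S3≡ IsDualSCITheoryOf S3) ×
    (S4≡ IsDualSCITheoryOf S4) × (S5≡ IsDualSCITheoryOf S5)
theorem5p9 = S1SP≡-dual , S3≡-dual , S4≡-dual , S5≡-dual
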